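{- Let $\kappa$ be a cardinal and assume $\mathsf{MA}_\kappa$. Let $X\subseteq\mathbb{R}$ be a set of cardinality $\kappa$, and let $\{A_x : x\in X\}$ be a real almost chain of subsets of $\omega$, i.e. $A_x\subseteq\omega$ for every $x\in X$ and $A_x\subseteq^* A_y$ whenever $x,y\in X$ and $x<y$. Then $\{A_x : x\in X\}$ has a barely alternating finite adjustment; that is, there is a family $\{B_x : x\in X\}$ of subsets of $\omega$ such that $B_x =^* A_x$ for all $x\in X$, and $B_{x_1}\cap B_{x_3}\subseteq B_{x_2}\cup B_{x_4}$ whenever $x_1<x_2<x_3<x_4$ are elements of $X$.
   Context: For sets $R,S$: $R\subseteq^* S$ means that $R\setminus S$ is finite, and $R=^*S$ means that $R\subseteq^* S$ and $S\subseteq^* R$. A real almost chain is a family of sets $\{A_x : x\in X\}$ indexed by a set $X\subseteq\mathbb{R}$ such that $A_x\subseteq^* A_y$ whenever $x<y$ in $X$. A family $\{B_x : x\in X\}$ is a finite adjustment of $\{A_x : x\in X\}$ if $A_x=^*B_x$ for all $x\in X$. A family $\{A_x : x\in X\}$ is barely alternating if $A_{x_1}\cap A_{x_3}\subseteq A_{x_2}\cup A_{x_4}$ whenever $x_1<x_2<x_3<x_4$ in $X$. Martin's Axiom $\mathsf{MA}_\kappa$ is the statement: for every nonempty partial order $\mathbb{P}$ satisfying the countable chain condition (every family of pairwise incompatible elements is countable) and every family $\mathcal{D}$ of at most $\kappa$ dense subsets of $\mathbb{P}$, there is a filter $G\subseteq\mathbb{P}$ with $G\cap D\neq\emptyset$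 for all $D\in\mathcal{D}$. -}

module Defs where

open import Data.List using (List)
import Data.List.Membership.Propositional as List
open import Data.Nat using (ℕ)
open import Data.Product using (∃; ∃-syntax; _×_; _,_; proj₁)
open import Data.Rational as ℚ using (ℚ)
open import Data.Sum using (_⊎_)
open import Function using (_⇔_; _↣_; Bijection; Func)
open import Level using (Level; Setω; 0ℓ; suc; _⊔_)
open import Relation.Binary using (Poset; Setoid)
open import Relation.Binary.PropositionalEquality using (_≢_; setoid)
import Relation.Binary.Construct.On as On
open import Relation.Nullary using (¬_)
open import Relation.Unary using (Pred; _∈_; _⊆_; _≐_; _∖_; _∩_; _∪_; Satisfiable)
open import Relation.Unary.Properties using (≐-refl; ≐-sym; ≐-trans)
open import Relation.Unary.Relation.Binary.Equality using (≐-setoid)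
open import Axiom.ExcludedMiddle using (ExcludedMiddle)

private
  variable
    a ℓ ℓ₁ ℓ₂ : Level

-- The ambient classical logic. Excluded middle is taken for all types, not
-- only propositions; as ∃ is Σ, ∀ x → ∃ y → R x y already yields a choice
-- function, so no separate choice axiom is assumed.
Classical : Setω
Classical = ∀ {ℓ} → ExcludedMiddle ℓ

-- Two-sided Dedekind cuts in ℚ.
record ℝ : Set₁ where
  field
    lower upper     : Pred ℚ 0ℓ
    lower-inhabited : Satisfiable lower
    upper-inhabited : Satisfiable upper
    lower-rounded   : ∀ q → q ∈ lower ⇔ (∃[ r ] q ℚ.< r × r ∈ lower)
    upper-rounded   : ∀ q → q ∈ upper ⇔ (∃[ r ] r ℚ.< q × r ∈ upper)
    disjoint        : ∀ q → ¬ (q ∈ lower × q ∈ upper)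
    located         : ∀ q r → q ℚ.< r → q ∈ lower ⊎ r ∈ upper

open ℝ

infix 4 _≃_ _<_

_≃_ : ℝ → ℝ → Set
x ≃ y = (lower x ≐ lower y) × (upper x ≐ upper y)

_<_ : ℝ → ℝ → Set
x < y = ∃[ q ] q ∈ upper x × q ∈ lower y

ℝ-setoid : Setoid (suc 0ℓ) 0ℓ
ℝ-setoid = record
  { Carrier       = ℝ
  ; _≈_           = _≃_
  ; isEquivalence = record
    { refl  = ≐-refl , ≐-refl
    ; sym   = λ (p , q) → ≐-sym p , ≐-sym q
    ; trans = λ (p , q) (p′ , q′) → ≐-trans p p′ , ≐-trans q q′
    }
  }

-- The elements of X ⊆ ℝ, identified when they are equal as reals. A predicate
-- X that does not respect _≃_ stands for its closure under _≃_.
⟪_⟫ : Pred ℝ ℓ → Setoid (suc 0ℓ ⊔ ℓ) 0ℓ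
⟪ X ⟫ = On.setoid {B = ∃ X} ℝ-setoid proj₁

-- Cardinals are represented by types, so κ stands for its own cardinality.
HasCardinality : Pred ℝ ℓ → Set → Set (suc 0ℓ ⊔ ℓ)
HasCardinality X κ = Bijection (setoid κ) ⟪ X ⟫

Finite : {S : Set a} → Pred S ℓ → Set (a ⊔ ℓ)
Finite R = ∃[ xs ] R ⊆ (List._∈ xs)

infix 4 _⊆*_ _=*_

_⊆*_ : {S : Set a} → Pred S ℓ₁ → Pred S ℓ₂ → Set (a ⊔ ℓ₁ ⊔ ℓ₂)
R ⊆* S = Finite (R ∖ S)

_=*_ : {S : Set a} → Pred S ℓ₁ → Pred S ℓ₂ → Set (a ⊔ ℓ₁ ⊔ ℓ₂)
R =* S = R ⊆* S × S ⊆* R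

-- Families of subsets of ω indexed by X; being a Func, a family assigns the
-- same set (up to _≐_) to equal reals.
Family : Pred ℝ ℓ → Set (suc 0ℓ ⊔ ℓ)
Family X = Func ⟪ X ⟫ (≐-setoid ℕ 0ℓ)

module _ {X : Pred ℝ ℓ} where

  infix 4 _≺_

  _≺_ : ∃ X → ∃ X → Set
  x ≺ y = proj₁ x < proj₁ y

  IsAlmostChain : Family X → Set (suc 0ℓ ⊔ ℓ)
  IsAlmostChain A = ∀ x y → x ≺ y → A.to x ⊆* A.to y
    where module A = Func A

  IsFiniteAdjustment : Family X → Family X → Set (suc 0ℓ ⊔ ℓ)
  IsFiniteAdjustment B A = ∀ x → A.to x =* B.to x
    where
    module A = Func A
    module B = Func B

  IsBarelyAlternating : Family X → Set (suc 0ℓ ⊔ ℓ)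
  IsBarelyAlternating B =
    ∀ x₁ x₂ x₃ x₄ → x₁ ≺ x₂ → x₂ ≺ x₃ → x₃ ≺ x₄ →
    (B.to x₁ ∩ B.to x₃) ⊆ (B.to x₂ ∪ B.to x₄)
    where module B = Func B

module _ (P : Poset 0ℓ 0ℓ 0ℓ) where

  open Poset P

  Compatible : Carrier → Carrier → Set
  Compatible p q = ∃[ r ] r ≤ p × r ≤ q

  -- Distinct indices carry incompatible elements, so the family is
  -- injective and its index set has the size of its range.
  PairwiseIncompatible : {I : Set} → (I → Carrier) → Set
  PairwiseIncompatible f = ∀ i j → i ≢ j → ¬ Compatible (f i) (f j)

  CountableChainCondition : Set₁
  CountableChainCondition =
    {I : Set} (f : I → Carrier) → PairwiseIncompatible f → I ↣ ℕ

  Dense : Pred Carrier 0ℓ → Set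
  Dense D = ∀ p → ∃[ q ] q ≤ p × q ∈ D

  record IsFilter (G : Pred Carrier 0ℓ) : Set where
    field
      nonempty      : Satisfiable G
      upward-closed : ∀ {p q} → p ≤ q → p ∈ G → q ∈ G
      directed      : ∀ {p q} → p ∈ G → q ∈ G →
                      ∃[ r ] r ∈ G × r ≤ p × r ≤ q

-- The injection J ↣ κ says that the family of dense sets has at most κ members.
MA : Set → Set₁
MA κ =
  (P : Poset 0ℓ 0ℓ 0ℓ) → Poset.Carrier P → CountableChainCondition P →
  (J : Set) → J ↣ κ →
  (D : J → Pred (Poset.Carrier P) 0ℓ) → (∀ j → Dense P (D j)) →
  ∃[ G ] IsFilter P G × (∀ j → Satisfiable (G ∩ D j))

{-# OPTIONS --safe #-}

-- Force with finite partial finite adjustments that are barely alternating,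
-- ordered by extension. A new index x is added to a condition by using A_x from
-- some stage on, where the sets already form a chain, and by copying the nearest
-- index below x before that stage; so the conditions with a given index in their
-- domain are dense, and no other dense sets are needed.
--
-- The order is σ-linked, hence ccc. Fix a countable set of points such that any
-- two indices have one of them weakly in between. To a condition attach finitely
-- many points separating its domain, a stage M from which it agrees with A and
-- from which A is a chain on its domain together with these points, and, for each
-- index, its position relative to the points and its values below M. If two
-- conditions have the same data, then so has their union, which is therefore
-- barely alternating below M; from M on, a descent can only occur between
-- two indices in the same position, so two descents would need three indices in
-- the same position, while each condition has at most one.
module Submission where

open import Defs
open import Data.Product using (∃-syntax; _×_)
open import Level using (Level)
open import Relation.Unary using (Pred)

open import Axiom.ExcludedMiddle using (ExcludedMiddle)
open import Data.Bool as Bool using (Bool; true; false; if_then_else_; T)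
import Data.Bool.Properties as Bool
open import Data.Empty using (⊥; ⊥-elim)
open import Data.Integer using (ℤ; +_; -[1+_])
open import Data.List using (List; []; _∷_; _++_; map; upTo; cartesianProductWith)
open import Data.List.Extrema.Nat using (max; xs≤max)
open import Data.List.Membership.Propositional using (_∈_; _∉_)
open import Data.List.Membership.Propositional.Properties
  using (∈-map⁺; ∈-map⁻; ∈-++⁺ˡ; ∈-++⁺ʳ; ∈-++⁻; ∈-upTo⁺; ∈-cartesianProductWith⁺)
import Data.List.Membership.DecPropositional as DecMembership
open import Data.List.Properties using (∷-injective; map-injective)
open import Data.List.Relation.Binary.Subset.Propositional using (_⊆_)
open import Data.List.Relation.Unary.All using (lookup)
open import Data.List.Relation.Unary.Any using (here; there)
open import Data.Nat as ℕ using (ℕ; zero; suc; z≤n; s≤s; _⊔_)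
import Data.Nat.Binary as ℕᵇ
import Data.Nat.Binary.Properties as ℕᵇ
import Data.Nat.Properties as ℕ
open import Data.Product using (_,_; ∃; Σ-syntax; proj₁; proj₂)
open import Data.Product.Properties using (,-injective)
open import Data.Rational as ℚ using (ℚ; mkℚ; 0ℚ)
import Data.Rational.Properties as ℚ
open import Data.Sum using (_⊎_; inj₁; inj₂; [_,_]′)
open import Function using (_↣_; mk↣; Injection; Injective; Func; Bijection; _∘_; Equivalence)
open import Function.Construct.Composition using (_↣-∘_)
open import Level using (0ℓ)
open import Relation.Binary using (Poset; Setoid; IsStrictTotalOrder; Tri; tri<; tri≈; tri>; Trichotomous)
import Relation.Binary.Construct.Interior.Symmetric as SymInterior
open import Relation.Binary.PropositionalEquality
  using (_≡_; _≢_; _≗_; refl; sym; trans; cong; subst; isEquivalence)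
open import Relation.Binary.Structures.Biased using (isStrictTotalOrderᶜ)
open import Relation.Unary using (_≐_)
open import Relation.Nullary using (¬_; yes; no; contradiction)
open import Relation.Nullary.Decidable using (⌊_⌋; toWitness; fromWitness; decidable-stable)

-- Countability

-- A self-delimiting code: `n` becomes `n` digits `2[1+_]` closed by one digit `1+[2_]`. Lists are
-- thus read back digit by digit, and injectivity reduces to that of the constructors.
push : ℕ → ℕᵇ.ℕᵇ → ℕᵇ.ℕᵇ
push zero    b = ℕᵇ.1+[2 b ]
push (suc n) b = ℕᵇ.2[1+ push n b ]

push-injective : ∀ {m n b c} → push m b ≡ push n c → m ≡ n × b ≡ c
push-injective {zero}  {zero}  eq = refl , ℕᵇ.1+[2_]-injective eq
push-injective {zero}  {suc n} ()
push-injective {suc m} {zero}  ()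
push-injective {suc m} {suc n} eq with push-injective {m} {n} (ℕᵇ.2[1+_]-injective eq)
... | refl , b≡c = refl , b≡c

push≢zero : ∀ {n b} → ℕᵇ.zero ≢ push n b
push≢zero {zero}  ()
push≢zero {suc n} ()

encode : List ℕ → ℕᵇ.ℕᵇ
encode []       = ℕᵇ.zero
encode (n ∷ ns) = push n (encode ns)

encode-injective : Injective _≡_ _≡_ encode
encode-injective {[]}     {[]}     eq = refl
encode-injective {[]}     {n ∷ ns} eq = ⊥-elim (push≢zero {n} eq)
encode-injective {m ∷ ms} {[]}     eq = ⊥-elim (push≢zero {m} (sym eq))
encode-injective {m ∷ ms} {n ∷ ns} eq with push-injective {m} {n} eq
... | refl , eq′ = cong (m ∷_) (encode-injective eq′)

private variable
  S U : Set

ℕ↣ℕ : ℕ ↣ ℕ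
ℕ↣ℕ = mk↣ λ eq → eq

List-↣ℕ : S ↣ ℕ → List S ↣ ℕ
List-↣ℕ f = mk↣ {to = λ xs → ℕᵇ.toℕ (encode (map (Injection.to f) xs))}
  λ eq → map-injective (Injection.injective f) (encode-injective (ℕᵇ.toℕ-injective eq))

×-↣ℕ : S ↣ ℕ → U ↣ ℕ → (S × U) ↣ ℕ
×-↣ℕ {S} {U} f g = List-↣ℕ ℕ↣ℕ ↣-∘ mk↣ {to = pair} pair-injective
  where
  pair : S × U → List ℕ
  pair (x , y) = Injection.to f x ∷ Injection.to g y ∷ []
  pair-injective : Injective _≡_ _≡_ pair
  pair-injective eq with ∷-injective eq
  ... | eq₁ , eq′ with Injection.injective f eq₁ | Injection.injective g (proj₁ (∷-injective eq′))
  ... | refl | refl = refl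

Bool↣ℕ : Bool ↣ ℕ
Bool↣ℕ = mk↣ {to = bit} bit-injective
  where
  bit : Bool → ℕ
  bit b = if b then 1 else 0
  bit-injective : Injective _≡_ _≡_ bit
  bit-injective {false} {false} _ = refl
  bit-injective {true}  {true}  _ = refl

ℤ↣ℕ : ℤ ↣ ℕ
ℤ↣ℕ = ×-↣ℕ Bool↣ℕ ℕ↣ℕ ↣-∘ mk↣ {to = signed} signed-injective
  where
  signed : ℤ → Bool × ℕ
  signed (+ n)    = true , n
  signed -[1+ n ] = false , n
  signed-injective : Injective _≡_ _≡_ signed
  signed-injective {+ _}      {+ _}      refl = refl
  signed-injective { -[1+ _ ]} { -[1+ _ ]} refl = refl

ℚ↣ℕ : ℚ ↣ ℕ
ℚ↣ℕ = ×-↣ℕ ℤ↣ℕ ℕ↣ℕ ↣-∘ mk↣ {to = fraction} fraction-injective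
  where
  fraction : ℚ → ℤ × ℕ
  fraction (mkℚ n d-1 _) = n , d-1
  fraction-injective : Injective _≡_ _≡_ fraction
  fraction-injective {mkℚ _ _ _} {mkℚ _ _ _} refl = refl

map-≡⇒≗ : {f g : S → U} {xs : List S} → map f xs ≡ map g xs →
  ∀ {x} → x ∈ xs → f x ≡ g x
map-≡⇒≗ eq (here refl) = proj₁ (∷-injective eq)
map-≡⇒≗ eq (there x∈)  = map-≡⇒≗ (proj₂ (∷-injective eq)) x∈

-- Eventual properties

Eventually : ∀ {ℓ} → Pred ℕ ℓ → Set ℓ
Eventually P = ∃[ N ] (∀ {n} → N ℕ.≤ n → P n)

module _ {ℓ₁ ℓ₂} {P : Pred ℕ ℓ₁} {Q : Pred ℕ ℓ₂} where

  eventually-map : (∀ {n} → P n → Q n) → Eventually P → Eventually Q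
  eventually-map f (N , p) = N , λ N≤n → f (p N≤n)

  eventually-× : Eventually P → Eventually Q → Eventually (λ n → P n × Q n)
  eventually-× (M , p) (N , q) =
    M ⊔ N , λ h → p (ℕ.m⊔n≤o⇒m≤o M N h) , q (ℕ.m⊔n≤o⇒n≤o M N h)

eventually-∈ : ∀ {ℓ} {P : S → Pred ℕ ℓ} (xs : List S) →
  (∀ {x} → x ∈ xs → Eventually (P x)) → Eventually (λ n → ∀ {x} → x ∈ xs → P x n)
eventually-∈ []       p = 0 , λ _ ()
eventually-∈ (x ∷ xs) p =
  eventually-map
    (λ where
      (px , pxs) (here refl)  → px
      (px , pxs) (there x∈xs) → pxs x∈xs)
    (eventually-× (p (here refl)) (eventually-∈ xs (p ∘ there)))

module _ {ℓ₁ ℓ₂} {P : Pred ℕ ℓ₁} {Q : Pred ℕ ℓ₂} where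

  eventually⇒⊆* : Eventually (λ n → P n → Q n) → P ⊆* Q
  eventually⇒⊆* (N , P⇒Q) = upTo N , λ {n} (p , ¬q) →
    [ ∈-upTo⁺ , (λ N≤n → contradiction (P⇒Q N≤n p) ¬q) ]′ (ℕ.<-≤-connex n N)

  ⊆*⇒eventually : ExcludedMiddle ℓ₂ → P ⊆* Q → Eventually (λ n → P n → Q n)
  -- All exceptions are listed in `xs`, so none lies past its maximum.
  ⊆*⇒eventually em (xs , ⊆xs) = suc (max 0 xs) , λ max<n p →
    decidable-stable em λ ¬q →
      contradiction (lookup (xs≤max 0 xs) (⊆xs (p , ¬q))) (ℕ.<⇒≱ max<n)

-- The order of the reals

open ℝ

lower<upper : ∀ x {q r} → lower x q → upper x r → q ℚ.< r
lower<upper x {q} {r} q∈ r∈ with ℚ.<-cmp q r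
... | tri< q<r _ _  = q<r
... | tri≈ _ refl _ = contradiction (q∈ , r∈) (disjoint x q)
... | tri> _ _ r<q  =
  contradiction (Equivalence.from (lower-rounded x r) (q , r<q , q∈) , r∈) (disjoint x r)

lower-downward : ∀ x {q r} → q ℚ.< r → lower x r → lower x q
lower-downward x q<r r∈ = Equivalence.from (lower-rounded x _) (_ , q<r , r∈)

ℝ-<-irrefl : ∀ x → ¬ x < x
ℝ-<-irrefl x (q , q∈ , q∈′) = disjoint x q (q∈′ , q∈)

ℝ-<-trans : ∀ x y z → x < y → y < z → x < z
ℝ-<-trans x y z (q , q∈x , q∈y) (r , r∈y , r∈z) =
  q , q∈x , lower-downward z (lower<upper y q∈y r∈y) r∈z

-- Roundedness leaves room for some `r` above `q` still in the lower cut of `x`. Locating `y`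
-- between `q` and `r` gives the claim, since `r` in the upper cut of `y` would put `y` below `x`.
ℝ-≮⇒lower : ∀ x y → ¬ y < x → ∀ {q} → lower x q → lower y q
ℝ-≮⇒lower x y y≮x {q} q∈ with Equivalence.to (lower-rounded x q) q∈
... | r , q<r , r∈ with located y q r q<r
...   | inj₁ q∈y = q∈y
...   | inj₂ r∈y = contradiction (r , r∈y , r∈) y≮x

ℝ-≮⇒upper : ∀ x y → ¬ x < y → ∀ {q} → upper x q → upper y q
ℝ-≮⇒upper x y x≮y {q} q∈ with Equivalence.to (upper-rounded x q) q∈
... | r , r<q , r∈ with located y r q r<q
...   | inj₁ r∈y = contradiction (r , r∈ , r∈y) x≮y
...   | inj₂ q∈y = q∈y

≮∧≯⇒≃ : ∀ x y → ¬ x < y → ¬ y < x → x ≃ y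
≮∧≯⇒≃ x y x≮y y≮x =
  (ℝ-≮⇒lower x y y≮x , ℝ-≮⇒lower y x x≮y) , (ℝ-≮⇒upper x y x≮y , ℝ-≮⇒upper y x y≮x)

<-resp-≃ : ∀ {x x′ y y′} → x ≃ x′ → y ≃ y′ → x < y → x′ < y′
<-resp-≃ (_ , upper⊆ , _) ((lower⊆ , _) , _) (q , q∈x , q∈y) = q , upper⊆ q∈x , lower⊆ q∈y

module _ (em : ExcludedMiddle 0ℓ) {I : Set} (real : I → ℝ) where

  -- Classically, i is a largest index below q among those that are at most r. If
  -- there is an index between real x and q, take r below that index; otherwise
  -- r = q and x itself qualifies.
  IsLanding : ℚ × ℚ → I → Set
  IsLanding (r , q) i =
    upper (real i) q × (∀ j → upper (real j) q → ¬ lower (real j) r → ¬ real i < real j)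

  -- The bounds are proved for every landing because `d` will later pick an arbitrary one. They hold
  -- because `i` itself is among the indices below `q` and not above `r`, while `q` lies below
  -- `real j`.
  landing-between : ∀ i j → real i < real j →
    ∃[ c ] ∃ (IsLanding c) × (∀ {k} → IsLanding c k → ¬ real k < real i × ¬ real j < real k)
  landing-between i j (q , q∈i , q∈j) with em {∃[ w ] real i < real w × upper (real w) q}
  ... | yes (w , (r , r∈i , r∈w) , q∈w) =
    (r , q) ,
    (w , q∈w , λ l _ r∉l (s , s∈w , s∈l) →
      r∉l (lower-downward (real l) (lower<upper (real w) r∈w s∈w) s∈l)) ,
    λ {k} (q∈k , largest) →
      largest i q∈i (λ r∈ → disjoint (real i) r (r∈ , r∈i)) ,
      λ j<k → ℝ-<-irrefl (real j) (ℝ-<-trans (real j) (real k) (real j) j<k (q , q∈k , q∈j))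
  ... | no none =
    (q , q) ,
    (i , q∈i , λ l q∈l _ i<l → none (l , i<l , q∈l)) ,
    λ {k} (q∈k , largest) →
      largest i q∈i (λ q∈ → disjoint (real i) q (q∈ , q∈i)) ,
      λ j<k → ℝ-<-irrefl (real j) (ℝ-<-trans (real j) (real k) (real j) j<k (q , q∈k , q∈j))

  -- The points are themselves indices, so `a` will have values at them and comparisons can pass
  -- through them. Choosing `c` before assuming `real i < real j` makes it a total function of the
  -- pair.
  countable-order-dense : I →
    ∃[ d ] (∀ i j → ∃[ c ] (real i < real j → ¬ real (d c) < real i × ¬ real j < real (d c)))
  countable-order-dense i₀ = d , between
    where
    d : ℚ × ℚ → I
    d c with em {∃ (IsLanding c)}
    ... | yes (i , _) = i
    ... | no  _       = i₀
    d-landing : ∀ c → ∃ (IsLanding c) → IsLanding c (d c)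
    d-landing c landing with em {∃ (IsLanding c)}
    ... | yes (_ , landing′) = landing′
    ... | no  ∄              = contradiction landing ∄
    between : ∀ i j → ∃[ c ] (real i < real j → ¬ real (d c) < real i × ¬ real j < real (d c))
    between i j with em {real i < real j}
    ... | no  i≮j = (0ℚ , 0ℚ) , λ i<j → contradiction i<j i≮j
    ... | yes i<j with landing-between i j i<j
    ...   | c , landing , bounds = c , λ _ → bounds (d-landing c landing)

-- Forcing with barely alternating partial adjustments

-- Indexing by `κ` instead of by reals, and using Boolean characteristic functions instead of
-- predicates, keeps the conditions in `Set`, where the posets of `MA` live.
HasBarelyAlternatingAdjustment : {κ : Set} → (κ → κ → Set) → (κ → ℕ → Bool) → Set
HasBarelyAlternatingAdjustment {κ} _⊏_ a =
  Σ[ b ∈ (κ → ℕ → Bool) ] (∀ k → Eventually (λ n → b k n ≡ a k n)) ×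
    (∀ n {k₁ k₂ k₃ k₄} → k₁ ⊏ k₂ → k₂ ⊏ k₃ → k₃ ⊏ k₄ →
      b k₁ n ≡ true → b k₂ n ≡ false → b k₃ n ≡ true → b k₄ n ≡ false → ⊥)

true≰false : ∀ {b c} → b ≡ true → c ≡ false → ¬ b Bool.≤ c
true≰false refl refl ()

-- The numbering increases from below to above, so that `side` is monotone.
position : ∀ {A B C : Set} → Tri A B C → ℕ
position (tri< _ _ _) = 0
position (tri≈ _ _ _) = 1
position (tri> _ _ _) = 2

module _ (em : ExcludedMiddle 0ℓ) {κ : Set} (_⊏_ : κ → κ → Set)
  (sto : IsStrictTotalOrder _≡_ _⊏_) where

  private module ⊏ = IsStrictTotalOrder sto

  open DecMembership ⊏._≟_ using (_∈?_)

  ⊏-irrefl : ∀ {k} → ¬ k ⊏ k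
  ⊏-irrefl = ⊏.irrefl refl

  -- Inserting one index into a finite alternating set

  BarelyAlternatingOn : List κ → (κ → Bool) → Set
  BarelyAlternatingOn F v = ∀ {k₁ k₂ k₃ k₄} →
    k₁ ∈ F → k₂ ∈ F → k₃ ∈ F → k₄ ∈ F → k₁ ⊏ k₂ → k₂ ⊏ k₃ → k₃ ⊏ k₄ →
    v k₁ ≡ true → v k₂ ≡ false → v k₃ ≡ true → v k₄ ≡ false → ⊥

  -- The greatest element of F below x has value true, phrased without maxima.
  TrueBelow : List κ → (κ → Bool) → κ → Set
  TrueBelow F v x = ∃[ k ] k ∈ F × k ⊏ x × v k ≡ true ×
    (∀ {l} → l ∈ F → k ⊏ l → l ⊏ x → v l ≡ true)

  module _ {F : List κ} {v : κ → Bool} {x : κ}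
    (true⇒ : v x ≡ true → TrueBelow F v x) (false⇒ : v x ≡ false → ¬ TrueBelow F v x) where

    private
      shift-first : ∀ {k} → k ∈ x ∷ F → v k ≡ true →
        ∃[ k′ ] k′ ∈ F × v k′ ≡ true × (∀ {m} → k ⊏ m → k′ ⊏ m)
      shift-first (there k∈F) eq = _ , k∈F , eq , λ h → h
      shift-first (here refl) eq with true⇒ eq
      ... | k , k∈F , k⊏x , eq′ , _ = k , k∈F , eq′ , ⊏.trans k⊏x

      -- The witness `k` of `TrueBelow` can replace `x`: it lies above `l`, since all values from
      -- `k` up to `x` are true and `l` has value false.
      shift-true : ∀ {l k} → l ∈ F → v l ≡ false → l ⊏ k → k ∈ x ∷ F → v k ≡ true →
        ∃[ k′ ] k′ ∈ F × v k′ ≡ true × l ⊏ k′ × (∀ {m} → k ⊏ m → k′ ⊏ m)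
      shift-true l∈F l≡f l⊏k (there k∈F) eq = _ , k∈F , eq , l⊏k , λ h → h
      shift-true {l} l∈F l≡f l⊏x (here refl) eq with true⇒ eq
      ... | k , k∈F , k⊏x , eq′ , above with ⊏.compare l k
      ...   | tri< l⊏k _ _  = k , k∈F , eq′ , l⊏k , ⊏.trans k⊏x
      ...   | tri≈ _ refl _ = contradiction (trans (sym l≡f) eq′) λ ()
      ...   | tri> _ _ k⊏l  = contradiction (trans (sym l≡f) (above l∈F k⊏l l⊏x)) λ ()

      -- Without a false index of `F` strictly between `l` and `x`, the true index `l` would witness
      -- `TrueBelow`, which a false value at `x` excludes.
      shift-false : ∀ {l k} → l ∈ F → v l ≡ true → l ⊏ k → k ∈ x ∷ F → v k ≡ false →
        ∃[ k′ ] k′ ∈ F × v k′ ≡ false × l ⊏ k′ × (∀ {m} → k ⊏ m → k′ ⊏ m)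
      shift-false l∈F l≡t l⊏k (there k∈F) eq = _ , k∈F , eq , l⊏k , λ h → h
      shift-false {l} l∈F l≡t l⊏x (here refl) eq
        with em {∃[ m ] m ∈ F × v m ≡ false × l ⊏ m × m ⊏ x}
      ... | yes (m , m∈F , m≡f , l⊏m , m⊏x) = m , m∈F , m≡f , l⊏m , ⊏.trans m⊏x
      ... | no  none = contradiction
        (l , l∈F , l⊏x , l≡t , λ {m} m∈F l⊏m m⊏x →
          Bool.¬-not λ m≡f → none (m , m∈F , m≡f , l⊏m , m⊏x))
        (false⇒ eq)

    -- A forbidden pattern through `x` is pushed into `F` from left to right. Each replacement moves
    -- an index only downwards and keeps it above its predecessor, so the order of the four
    -- survives.
    insert-alternating : BarelyAlternatingOn F v → BarelyAlternatingOn (x ∷ F) v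
    insert-alternating alt k₁∈ k₂∈ k₃∈ k₄∈ k₁⊏k₂ k₂⊏k₃ k₃⊏k₄ eq₁ eq₂ eq₃ eq₄
      with shift-first k₁∈ eq₁
    ... | _ , k₁∈′ , eq₁′ , below₁ with shift-false k₁∈′ eq₁′ (below₁ k₁⊏k₂) k₂∈ eq₂
    ... | _ , k₂∈′ , eq₂′ , k₁⊏k₂′ , below₂ with shift-true k₂∈′ eq₂′ (below₂ k₂⊏k₃) k₃∈ eq₃
    ... | _ , k₃∈′ , eq₃′ , k₂⊏k₃′ , below₃ with shift-false k₃∈′ eq₃′ (below₃ k₃⊏k₄) k₄∈ eq₄
    ... | _ , k₄∈′ , eq₄′ , k₃⊏k₄′ , _ =
      alt k₁∈′ k₂∈′ k₃∈′ k₄∈′ k₁⊏k₂′ k₂⊏k₃′ k₃⊏k₄′ eq₁′ eq₂′ eq₃′ eq₄′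

  module _ (a : κ → ℕ → Bool)
    (a-chain : ∀ {k l} → k ⊏ l → Eventually λ n → a k n Bool.≤ a l n) where

    -- The poset of conditions

    record Condition : Set where
      field
        dom        : List κ
        -- Only the values at indices in dom are relevant.
        val        : κ → ℕ → Bool
        adjusts    : Eventually (λ n → ∀ {k} → k ∈ dom → val k n ≡ a k n)
        alternates : ∀ n → BarelyAlternatingOn dom (λ k → val k n)

    open Condition

    empty : Condition
    empty = record
      { dom        = []
      ; val        = a
      ; adjusts    = 0 , λ _ ()
      ; alternates = λ _ ()
      }

    infix 4 _≼_

    _≼_ : Condition → Condition → Set
    q ≼ p = dom p ⊆ dom q × (∀ {k} → k ∈ dom p → val q k ≗ val p k)

    ≼-refl : ∀ {p} → p ≼ p
    ≼-refl = (λ k∈ → k∈) , λ _ _ → refl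

    ≼-trans : ∀ {r q p} → r ≼ q → q ≼ p → r ≼ p
    ≼-trans (⊆₁ , eq₁) (⊆₂ , eq₂) =
      ⊆₁ ∘ ⊆₂ , λ k∈ n → trans (eq₁ (⊆₂ k∈) n) (eq₂ k∈ n)

    -- Extension is only a preorder, since conditions may differ in the listing of `dom` and in
    -- values off it; equality is therefore taken to be mutual extension.
    conditions : Poset 0ℓ 0ℓ 0ℓ
    conditions = SymInterior.poset {R = _≼_} (λ {p} → ≼-refl {p})
      (λ {r} {q} {p} → ≼-trans {r} {q} {p})

    eventually-monotone : (F : List κ) →
      Eventually (λ n → ∀ {k} → k ∈ F → ∀ {l} → l ∈ F → k ⊏ l → a k n Bool.≤ a l n)
    eventually-monotone F = eventually-∈ F λ {k} _ → eventually-∈ F λ {l} _ → pair k l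
      where
      pair : ∀ k l → Eventually (λ n → k ⊏ l → a k n Bool.≤ a l n)
      pair k l with k ⊏.<? l
      ... | yes k⊏l = eventually-map (λ h _ → h) (a-chain k⊏l)
      ... | no  k⋢l = 0 , λ _ k⊏l → contradiction k⊏l k⋢l

    -- Density: adding an index to a condition

    module _ (p : Condition) (x : κ) (x∉p : x ∉ dom p) where

      private
        stage : Eventually _
        stage = eventually-× (adjusts p) (eventually-monotone (x ∷ dom p))

        N : ℕ
        N = proj₁ stage

        Below : ℕ → Set
        Below n = TrueBelow (dom p) (λ k → val p k n) x

        xval : ℕ → Bool
        xval n with N ℕ.≤? n
        ... | yes _ = a x n
        -- If no index of `dom p` lies below `x`, the value is false.
        ... | no  _ = ⌊ em {Below n} ⌋

        newval : κ → ℕ → Bool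
        newval k with k ⊏.≟ x
        ... | yes _ = xval
        ... | no  _ = val p k

        newval-x : newval x ≡ xval
        newval-x with x ⊏.≟ x
        ... | yes _   = refl
        ... | no  x≢x = contradiction refl x≢x

        newval-p : ∀ {k} → k ∈ dom p → newval k ≡ val p k
        newval-p {k} k∈p with k ⊏.≟ x
        ... | yes refl = contradiction k∈p x∉p
        ... | no  _    = refl

        xval-late : ∀ {n} → N ℕ.≤ n → xval n ≡ a x n
        xval-late {n} N≤n with N ℕ.≤? n
        ... | yes _   = refl
        ... | no  N≰n = contradiction N≤n N≰n

        newval-late : ∀ {n} → N ℕ.≤ n → ∀ {k} → k ∈ x ∷ dom p → newval k n ≡ a k n
        newval-late {n} N≤n (here refl) = trans (cong (λ f → f n) newval-x) (xval-late N≤n)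
        newval-late {n} N≤n (there k∈p) =
          trans (cong (λ f → f n) (newval-p k∈p)) (proj₁ (proj₂ stage N≤n) k∈p)

        newval≗ : ∀ n {k b} → k ∈ dom p → newval k n ≡ b → val p k n ≡ b
        newval≗ n k∈p = trans (cong (λ f → f n) (sym (newval-p k∈p)))

        ≗newval : ∀ n {k b} → k ∈ dom p → val p k n ≡ b → newval k n ≡ b
        ≗newval n k∈p = trans (cong (λ f → f n) (newval-p k∈p))

        xval-true : ∀ {n} → ¬ N ℕ.≤ n → xval n ≡ true → Below n
        xval-true {n} N≰n eq with N ℕ.≤? n
        ... | yes N≤n = contradiction N≤n N≰n
        ... | no  _   with em {Below n}
        ...   | yes below = below

        xval-false : ∀ {n} → ¬ N ℕ.≤ n → xval n ≡ false → ¬ Below n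
        xval-false {n} N≰n eq with N ℕ.≤? n
        ... | yes N≤n = contradiction N≤n N≰n
        ... | no  _   with em {Below n}
        ...   | no ¬below = ¬below

        newval-alternates : ∀ n → BarelyAlternatingOn (x ∷ dom p) (λ k → newval k n)
        newval-alternates n with N ℕ.≤? n
        -- The stage was chosen for `x ∷ dom p`, so the first descent of the pattern already
        -- contradicts monotonicity.
        ... | yes N≤n = λ k₁∈ k₂∈ _ _ k₁⊏k₂ _ _ eq₁ eq₂ _ _ →
          true≰false (trans (sym (newval-late N≤n k₁∈)) eq₁)
            (trans (sym (newval-late N≤n k₂∈)) eq₂)
            (proj₂ (proj₂ stage N≤n) k₁∈ k₂∈ k₁⊏k₂)
        ... | no N≰n = insert-alternating
          (λ eq → to-new (xval-true N≰n (trans (cong (λ f → f n) (sym newval-x)) eq)))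
          (λ eq below →
            xval-false N≰n (trans (cong (λ f → f n) (sym newval-x)) eq) (from-new below))
          λ k₁∈ k₂∈ k₃∈ k₄∈ h₁ h₂ h₃ eq₁ eq₂ eq₃ eq₄ →
            alternates p n k₁∈ k₂∈ k₃∈ k₄∈ h₁ h₂ h₃
              (newval≗ n k₁∈ eq₁) (newval≗ n k₂∈ eq₂) (newval≗ n k₃∈ eq₃) (newval≗ n k₄∈ eq₄)
          where
          to-new : Below n → TrueBelow (dom p) (λ k → newval k n) x
          to-new (k , k∈ , k⊏x , eq , above) =
            k , k∈ , k⊏x , ≗newval n k∈ eq ,
            λ l∈ k⊏l l⊏x → ≗newval n l∈ (above l∈ k⊏l l⊏x)
          from-new : TrueBelow (dom p) (λ k → newval k n) x → Below n
          from-new (k , k∈ , k⊏x , eq , above) =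
            k , k∈ , k⊏x , newval≗ n k∈ eq ,
            λ l∈ k⊏l l⊏x → newval≗ n l∈ (above l∈ k⊏l l⊏x)

      insert : Condition
      insert = record
        { dom        = x ∷ dom p
        ; val        = newval
        ; adjusts    = N , newval-late
        ; alternates = newval-alternates
        }

      insert-≼ : insert ≼ p
      insert-≼ = there , λ k∈p n → cong (λ f → f n) (newval-p k∈p)

    dom-dense : ∀ x → Dense conditions (λ p → x ∈ dom p)
    dom-dense x p with x ∈? dom p
    ... | yes x∈p = p , ≼-refl {p} , x∈p
    ... | no  x∉p = insert p x x∉p , insert-≼ p x x∉p , here refl

    -- Each `b x` is read off one chosen condition of `G` containing `x`. A violation involves only
    -- four indices, and directedness puts their conditions under a single `t`, which agrees with
    -- `b` there and alternates.
    generic-adjustment :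
      (G : Pred Condition 0ℓ) → IsFilter conditions G →
      (∀ x → ∃[ p ] G p × x ∈ dom p) →
      HasBarelyAlternatingAdjustment _⊏_ a
    generic-adjustment G filter meets = b , b-adjusts , b-alternates
      where
      open IsFilter filter
      at : κ → Condition
      at x = proj₁ (meets x)
      at∈G : ∀ x → G (at x)
      at∈G x = proj₁ (proj₂ (meets x))
      ∈at : ∀ x → x ∈ dom (at x)
      ∈at x = proj₂ (proj₂ (meets x))
      b : κ → ℕ → Bool
      b x = val (at x) x
      b-adjusts : ∀ k → Eventually (λ n → b k n ≡ a k n)
      b-adjusts k = eventually-map (λ h → h (∈at k)) (adjusts (at k))
      b-alternates : ∀ n {k₁ k₂ k₃ k₄} → k₁ ⊏ k₂ → k₂ ⊏ k₃ → k₃ ⊏ k₄ →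
        b k₁ n ≡ true → b k₂ n ≡ false → b k₃ n ≡ true → b k₄ n ≡ false → ⊥
      b-alternates n {k₁} {k₂} {k₃} {k₄} h₁ h₂ h₃ eq₁ eq₂ eq₃ eq₄
        with directed (at∈G k₁) (at∈G k₂) | directed (at∈G k₃) (at∈G k₄)
      ... | r , r∈G , r≼₁ , r≼₂ | s , s∈G , s≼₃ , s≼₄ with directed r∈G s∈G
      ... | t , _ , t≼r , t≼s =
        alternates t n (∈t k₁ t≼₁) (∈t k₂ t≼₂) (∈t k₃ t≼₃) (∈t k₄ t≼₄) h₁ h₂ h₃
          (trans (agree k₁ t≼₁) eq₁) (trans (agree k₂ t≼₂) eq₂)
          (trans (agree k₃ t≼₃) eq₃) (trans (agree k₄ t≼₄) eq₄)
        where
        ∈t : ∀ k → t ≼ at k → k ∈ dom t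
        ∈t k t≼ = proj₁ t≼ (∈at k)
        agree : ∀ k → t ≼ at k → val t k n ≡ b k n
        agree k t≼ = proj₂ t≼ (∈at k) n
        t≼₁ : t ≼ at k₁
        t≼₁ = ≼-trans {t} {r} {at k₁} t≼r r≼₁
        t≼₂ : t ≼ at k₂
        t≼₂ = ≼-trans {t} {r} {at k₂} t≼r r≼₂
        t≼₃ : t ≼ at k₃
        t≼₃ = ≼-trans {t} {s} {at k₃} t≼s s≼₃
        t≼₄ : t ≼ at k₄
        t≼₄ = ≼-trans {t} {s} {at k₄} t≼s s≼₄

    -- The countable chain condition

    side : κ → κ → ℕ
    side k e = position (⊏.compare k e)

    side≤1 : ∀ k e → side k e ℕ.≤ 1 → k ⊏ e ⊎ k ≡ e
    side≤1 k e h with ⊏.compare k e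
    ... | tri< k⊏e _ _ = inj₁ k⊏e
    ... | tri≈ _ k≡e _ = inj₂ k≡e
    side≤1 k e (s≤s ()) | tri> _ _ _

    1≤side : ∀ k e → 1 ℕ.≤ side k e → e ⊏ k ⊎ k ≡ e
    1≤side k e h with ⊏.compare k e
    ... | tri≈ _ k≡e _ = inj₂ k≡e
    ... | tri> _ _ e⊏k = inj₁ e⊏k

    side≤2 : ∀ k e → side k e ℕ.≤ 2
    side≤2 k e with ⊏.compare k e
    ... | tri< _ _ _ = z≤n
    ... | tri≈ _ _ _ = s≤s z≤n
    ... | tri> _ _ _ = ℕ.≤-refl

    side-mono : ∀ {k l} e → k ⊏ l → side k e ℕ.≤ side l e
    side-mono {k} {l} e k⊏l with ⊏.compare k e | ⊏.compare l e
    ... | tri< _ _ _    | _             = z≤n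
    ... | tri≈ _ refl _ | tri< l⊏k _ _  = contradiction l⊏k (⊏.asym k⊏l)
    ... | tri≈ _ _ _    | tri≈ _ _ _    = ℕ.≤-refl
    ... | tri≈ _ _ _    | tri> _ _ _    = s≤s z≤n
    ... | tri> _ _ e⊏k  | tri< l⊏e _ _  = contradiction (⊏.trans l⊏e e⊏k) (⊏.asym k⊏l)
    ... | tri> _ _ e⊏k  | tri≈ _ refl _ = contradiction e⊏k (⊏.asym k⊏l)
    ... | tri> _ _ _    | tri> _ _ _    = ℕ.≤-refl

    side-cancel-< : ∀ {k l} e → side k e ℕ.< side l e → k ⊏ l
    side-cancel-< {k} {l} e h with ⊏.compare k l
    ... | tri< k⊏l _ _  = k⊏l
    ... | tri≈ _ refl _ = contradiction h (ℕ.<-irrefl refl)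
    ... | tri> _ _ l⊏k  = contradiction h (ℕ.≤⇒≯ (side-mono e l⊏k))

    -- Here `k` is at or below `e` and `l` at or above it; they cannot both be at `e`.
    between⇒side-< : ∀ {k l} e → k ⊏ l → ¬ e ⊏ k → ¬ l ⊏ e → side k e ℕ.< side l e
    between⇒side-< {k} {l} e k⊏l e⋢k l⋢e with ⊏.compare k e | ⊏.compare l e
    ... | tri> _ _ e⊏k  | _             = contradiction e⊏k e⋢k
    ... | tri< _ _ _    | tri< l⊏e _ _  = contradiction l⊏e l⋢e
    ... | tri≈ _ _ _    | tri< l⊏e _ _  = contradiction l⊏e l⋢e
    ... | tri< _ _ _    | tri≈ _ _ _    = s≤s z≤n
    ... | tri< _ _ _    | tri> _ _ _    = s≤s z≤n
    ... | tri≈ _ refl _ | tri≈ _ refl _ = contradiction k⊏l ⊏-irrefl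
    ... | tri≈ _ _ _    | tri> _ _ _    = ℕ.≤-refl

    -- Finite data attached to a condition

    module _ {C : Set} (C↣ℕ : C ↣ ℕ) (d : C → κ)
      (between : ∀ k l → ∃[ c ] (k ⊏ l → ¬ d c ⊏ k × ¬ l ⊏ d c)) where

      -- In `monotone` the points join the domain so that indices of two different conditions can
      -- later be compared through a shared point.
      record IsBlueprint (p : Condition) (cs : List C) (M : ℕ) : Set where
        field
          separates : ∀ {k l} → k ∈ dom p → l ∈ dom p → k ⊏ l →
            ∃[ c ] c ∈ cs × side k (d c) ℕ.< side l (d c)
          agrees    : ∀ {n} → M ℕ.≤ n → ∀ {k} → k ∈ dom p → val p k n ≡ a k n
          monotone  : ∀ {n} → M ℕ.≤ n → ∀ {k} → k ∈ dom p ++ map d cs →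
            ∀ {l} → l ∈ dom p ++ map d cs → k ⊏ l → a k n Bool.≤ a l n

      open IsBlueprint

      blueprint : ∀ p → ∃[ cs ] ∃[ M ] IsBlueprint p cs M
      blueprint p = cs , proj₁ stage , record
        { separates = λ {k} {l} k∈ l∈ k⊏l →
            separator k l , ∈-cartesianProductWith⁺ separator k∈ l∈ ,
            (let e⋢k , l⋢e = proj₂ (between k l) k⊏l in between⇒side-< _ k⊏l e⋢k l⋢e)
        ; agrees    = λ M≤n → proj₁ (proj₂ stage M≤n)
        ; monotone  = λ M≤n → proj₂ (proj₂ stage M≤n)
        }
        where
        separator : κ → κ → C
        separator k l = proj₁ (between k l)
        cs : List C
        cs = cartesianProductWith separator (dom p) (dom p)
        stage : Eventually _
        stage = eventually-× (adjusts p) (eventually-monotone (dom p ++ map d cs))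

      module _ (cs : List C) (M : ℕ) where

        -- The indices themselves are left out, as there may be uncountably many; positions and
        -- early values range over a countable set.
        profile : Condition → List (List ℕ × List Bool)
        profile p = map (λ k → map (λ c → side k (d c)) cs , map (val p k) (upTo M)) (dom p)

        SameSide : κ → κ → Set
        SameSide k l = ∀ {c} → c ∈ cs → side k (d c) ≡ side l (d c)

        ≡-profile⇒twin : ∀ p q → profile p ≡ profile q → ∀ {k} → k ∈ dom p →
          ∃[ k′ ] k′ ∈ dom q × SameSide k k′ × (∀ {n} → n ℕ.< M → val p k n ≡ val q k′ n)
        ≡-profile⇒twin p q eq {k} k∈p with ∈-map⁻ _ (subst (_ ∈_) eq (∈-map⁺ _ k∈p))
        ... | k′ , k′∈q , eq′ with ,-injective eq′
        ...   | sides , values =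
          k′ , k′∈q , map-≡⇒≗ sides , λ n<M → map-≡⇒≗ values (∈-upTo⁺ n<M)

        SameSide-unique : ∀ {p} → IsBlueprint p cs M → ∀ {k l} → k ∈ dom p → l ∈ dom p →
          SameSide k l → k ≡ l
        SameSide-unique bp {k} {l} k∈ l∈ same with ⊏.compare k l
        ... | tri≈ _ k≡l _ = k≡l
        ... | tri< k⊏l _ _ with separates bp k∈ l∈ k⊏l
        ...   | _ , c∈ , h = contradiction h (ℕ.<-irrefl (same c∈))
        SameSide-unique bp {k} {l} k∈ l∈ same | tri> _ _ l⊏k with separates bp l∈ k∈ l⊏k
        ...   | _ , c∈ , h = contradiction h (ℕ.<-irrefl (sym (same c∈)))

        private
          ≤point : ∀ {p} → IsBlueprint p cs M → ∀ {n} → M ℕ.≤ n → ∀ {k c} →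
            k ∈ dom p → c ∈ cs → side k (d c) ℕ.≤ 1 → a k n Bool.≤ a (d c) n
          ≤point {p} bp M≤n {k} {c} k∈ c∈ h with side≤1 k (d c) h
          ... | inj₁ k⊏d  = monotone bp M≤n (∈-++⁺ˡ k∈) (∈-++⁺ʳ (dom p) (∈-map⁺ d c∈)) k⊏d
          ... | inj₂ refl = Bool.≤-refl

          point≤ : ∀ {p} → IsBlueprint p cs M → ∀ {n} → M ℕ.≤ n → ∀ {k c} →
            k ∈ dom p → c ∈ cs → 1 ℕ.≤ side k (d c) → a (d c) n Bool.≤ a k n
          point≤ {p} bp M≤n {k} {c} k∈ c∈ h with 1≤side k (d c) h
          ... | inj₁ d⊏k  = monotone bp M≤n (∈-++⁺ʳ (dom p) (∈-map⁺ d c∈)) (∈-++⁺ˡ k∈) d⊏k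
          ... | inj₂ refl = Bool.≤-refl

        -- Amalgamating two conditions with the same data

        module _ (p q : Condition) (bp : IsBlueprint p cs M) (bq : IsBlueprint q cs M)
          (eq : profile p ≡ profile q) where

          private
            both : List κ
            both = dom p ++ dom q

            uval : κ → ℕ → Bool
            uval k with k ∈? dom p
            ... | yes _ = val p k
            ... | no  _ = val q k

            uval-p : ∀ {k} → k ∈ dom p → uval k ≗ val p k
            uval-p {k} k∈p n with k ∈? dom p
            ... | yes _   = refl
            ... | no  k∉p = contradiction k∈p k∉p

            -- On a common index, both conditions agree with `a` from `M` on. Below `M`, the twin of
            -- `k` in `dom q` shares the position of `k`, hence is `k` itself.
            uval-q : ∀ {k} → k ∈ dom q → uval k ≗ val q k
            uval-q {k} k∈q n with k ∈? dom p
            ... | no  _   = refl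
            ... | yes k∈p with n ℕ.<? M
            ...   | no n≮M = trans (agrees bp (ℕ.≮⇒≥ n≮M) k∈p) (sym (agrees bq (ℕ.≮⇒≥ n≮M) k∈q))
            ...   | yes n<M with ≡-profile⇒twin p q eq k∈p
            ...     | k′ , k′∈q , same , values with SameSide-unique bq k∈q k′∈q same
            ...       | refl = values n<M

            uval-late : ∀ {n} → M ℕ.≤ n → ∀ {k} → k ∈ both → uval k n ≡ a k n
            uval-late {n} M≤n k∈ with ∈-++⁻ (dom p) k∈
            ... | inj₁ k∈p = trans (uval-p k∈p n) (agrees bp M≤n k∈p)
            ... | inj₂ k∈q = trans (uval-q k∈q n) (agrees bq M≤n k∈q)

            twin : ∀ {n} → n ℕ.< M → ∀ {k b} → k ∈ both → uval k n ≡ b →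
              ∃[ k′ ] k′ ∈ dom p × SameSide k k′ × val p k′ n ≡ b
            twin {n} n<M {k} k∈ eq-b with ∈-++⁻ (dom p) k∈
            ... | inj₁ k∈p = k , k∈p , (λ _ → refl) , trans (sym (uval-p k∈p n)) eq-b
            ... | inj₂ k∈q with ≡-profile⇒twin q p (sym eq) k∈q
            ...   | k′ , k′∈p , same , values =
              k′ , k′∈p , same , trans (sym (values n<M)) (trans (sym (uval-q k∈q n)) eq-b)

            -- Different values exclude equal twins, and a point separating twins in reversed order
            -- would reverse `k` and `l` too. Neighbours in a forbidden pattern do have different
            -- values.
            twin-⊏ : ∀ {n k k′ l l′ b b′} → k ⊏ l → b ≢ b′ →
              k′ ∈ dom p → SameSide k k′ → val p k′ n ≡ b →
              l′ ∈ dom p → SameSide l l′ → val p l′ n ≡ b′ → k′ ⊏ l′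
            twin-⊏ {k′ = k′} {l′ = l′} k⊏l b≢b′ k′∈ same eq-b l′∈ same′ eq-b′
              with ⊏.compare k′ l′
            ... | tri< k′⊏l′ _ _ = k′⊏l′
            ... | tri≈ _ refl _  = contradiction (trans (sym eq-b) eq-b′) b≢b′
            ... | tri> _ _ l′⊏k′ with separates bp l′∈ k′∈ l′⊏k′
            ...   | c , c∈ , h rewrite sym (same c∈) | sym (same′ c∈) =
              contradiction (side-cancel-< (d c) h) (⊏.asym k⊏l)

            early : ∀ {n} → n ℕ.< M → BarelyAlternatingOn both (λ k → uval k n)
            early {n} n<M k₁∈ k₂∈ k₃∈ k₄∈ h₁ h₂ h₃ eq₁ eq₂ eq₃ eq₄
              with twin n<M k₁∈ eq₁ | twin n<M k₂∈ eq₂ | twin n<M k₃∈ eq₃ | twin n<M k₄∈ eq₄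
            ... | _ , ∈₁ , same₁ , eq₁′ | _ , ∈₂ , same₂ , eq₂′
                | _ , ∈₃ , same₃ , eq₃′ | _ , ∈₄ , same₄ , eq₄′ =
              alternates p n ∈₁ ∈₂ ∈₃ ∈₄
                (twin-⊏ h₁ (λ ()) ∈₁ same₁ eq₁′ ∈₂ same₂ eq₂′)
                (twin-⊏ h₂ (λ ()) ∈₂ same₂ eq₂′ ∈₃ same₃ eq₃′)
                (twin-⊏ h₃ (λ ()) ∈₃ same₃ eq₃′ ∈₄ same₄ eq₄′)
                eq₁′ eq₂′ eq₃′ eq₄′

            ≤point-both : ∀ {n} → M ℕ.≤ n → ∀ {k c} → k ∈ both → c ∈ cs →
              side k (d c) ℕ.≤ 1 → a k n Bool.≤ a (d c) n
            ≤point-both M≤n k∈ c∈ with ∈-++⁻ (dom p) k∈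
            ... | inj₁ k∈p = ≤point bp M≤n k∈p c∈
            ... | inj₂ k∈q = ≤point bq M≤n k∈q c∈

            point≤-both : ∀ {n} → M ℕ.≤ n → ∀ {k c} → k ∈ both → c ∈ cs →
              1 ℕ.≤ side k (d c) → a (d c) n Bool.≤ a k n
            point≤-both M≤n k∈ c∈ with ∈-++⁻ (dom p) k∈
            ... | inj₁ k∈p = point≤ bp M≤n k∈p c∈
            ... | inj₂ k∈q = point≤ bq M≤n k∈q c∈

            -- If a point told `k` and `l` apart, `k` would be at or below it and `l` at or above,
            -- so `a` would be monotone from `k` through the point to `l`, even when `k` and `l`
            -- come from different conditions.
            descent⇒SameSide : ∀ {n} → M ℕ.≤ n → ∀ {k l} → k ∈ both → l ∈ both → k ⊏ l →
              uval k n ≡ true → uval l n ≡ false → SameSide k l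
            descent⇒SameSide {n} M≤n {k} {l} k∈ l∈ k⊏l eq-t eq-f {c} c∈
              with ℕ.m≤n⇒m<n∨m≡n (side-mono (d c) k⊏l)
            ... | inj₂ same = same
            ... | inj₁ k<l  = contradiction
              (Bool.≤-trans
                (≤point-both M≤n k∈ c∈ (ℕ.≤-pred (ℕ.≤-trans k<l (side≤2 l (d c)))))
                (point≤-both M≤n l∈ c∈ (ℕ.≤-trans (s≤s z≤n) k<l)))
              (true≰false (trans (sym (uval-late M≤n k∈)) eq-t)
                (trans (sym (uval-late M≤n l∈)) eq-f))

            ⊏-unique : ∀ {r} → IsBlueprint r cs M → ∀ {k l} → k ∈ dom r → l ∈ dom r →
              SameSide k l → ¬ k ⊏ l
            ⊏-unique br k∈ l∈ same k⊏l with SameSide-unique br k∈ l∈ same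
            ... | refl = ⊏-irrefl k⊏l

            -- By pigeonhole, two of the three indices lie in the same domain.
            no-three-SameSide : ∀ {k l m} → k ∈ both → l ∈ both → m ∈ both →
              k ⊏ l → l ⊏ m → SameSide k l → ¬ SameSide l m
            no-three-SameSide k∈ l∈ m∈ k⊏l l⊏m kl lm
              with ∈-++⁻ (dom p) k∈ | ∈-++⁻ (dom p) l∈ | ∈-++⁻ (dom p) m∈
            ... | inj₁ k∈p | inj₁ l∈p | _        = ⊏-unique bp k∈p l∈p kl k⊏l
            ... | inj₂ k∈q | inj₂ l∈q | _        = ⊏-unique bq k∈q l∈q kl k⊏l
            ... | inj₁ _   | inj₂ l∈q | inj₂ m∈q = ⊏-unique bq l∈q m∈q lm l⊏m
            ... | inj₂ _   | inj₁ l∈p | inj₁ m∈p = ⊏-unique bp l∈p m∈p lm l⊏m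
            ... | inj₁ k∈p | inj₂ _   | inj₁ m∈p =
              ⊏-unique bp k∈p m∈p (λ c∈ → trans (kl c∈) (lm c∈)) (⊏.trans k⊏l l⊏m)
            ... | inj₂ k∈q | inj₁ _   | inj₂ m∈q =
              ⊏-unique bq k∈q m∈q (λ c∈ → trans (kl c∈) (lm c∈)) (⊏.trans k⊏l l⊏m)

            late : ∀ {n} → M ℕ.≤ n → BarelyAlternatingOn both (λ k → uval k n)
            late M≤n k₁∈ k₂∈ k₃∈ k₄∈ h₁ h₂ h₃ eq₁ eq₂ eq₃ eq₄ =
              no-three-SameSide k₁∈ k₂∈ k₃∈ h₁ h₂ same₁₂
                λ c∈ → trans (sym (same₁₂ c∈)) (trans (same₁₄ c∈) (sym (same₃₄ c∈)))
              where
              same₁₂ = descent⇒SameSide M≤n k₁∈ k₂∈ h₁ eq₁ eq₂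
              -- The long descent from first to last links the two short ones, so all four indices
              -- share one position.
              same₁₄ = descent⇒SameSide M≤n k₁∈ k₄∈ (⊏.trans h₁ (⊏.trans h₂ h₃)) eq₁ eq₄
              same₃₄ = descent⇒SameSide M≤n k₃∈ k₄∈ h₃ eq₃ eq₄

            uval-alternates : ∀ n → BarelyAlternatingOn both (λ k → uval k n)
            uval-alternates n with n ℕ.<? M
            ... | yes n<M = early n<M
            ... | no  n≮M = late (ℕ.≮⇒≥ n≮M)

          ≡-profile⇒Compatible : Compatible conditions p q
          ≡-profile⇒Compatible =
            record
              { dom        = both
              ; val        = uval
              ; adjusts    = M , uval-late
              ; alternates = uval-alternates
              } ,
            (∈-++⁺ˡ , uval-p) , (∈-++⁺ʳ (dom p) , uval-q)

      Code : Set
      Code = List C × ℕ × List (List ℕ × List Bool)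

      Code↣ℕ : Code ↣ ℕ
      Code↣ℕ = ×-↣ℕ (List-↣ℕ C↣ℕ) (×-↣ℕ ℕ↣ℕ (List-↣ℕ (×-↣ℕ (List-↣ℕ ℕ↣ℕ) (List-↣ℕ Bool↣ℕ))))

      code : Condition → Code
      code p = let cs , M , _ = blueprint p in cs , M , profile cs M p

      ≡-code⇒Compatible : ∀ p q → code p ≡ code q → Compatible conditions p q
      ≡-code⇒Compatible p q = helper (proj₂ (proj₂ (blueprint p))) (proj₂ (proj₂ (blueprint q)))
        where
        -- The computed points and stages become variables, so that equality of codes can be matched
        -- with `refl`.
        helper : ∀ {cs cs′ M M′} → IsBlueprint p cs M → IsBlueprint q cs′ M′ →
          _≡_ {A = Code} (cs , M , profile cs M p) (cs′ , M′ , profile cs′ M′ q) →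
          Compatible conditions p q
        helper bp bq eq with ,-injective eq
        ... | refl , eq′ with ,-injective eq′
        ...   | refl , eq″ = ≡-profile⇒Compatible _ _ p q bp bq eq″

      ccc : CountableChainCondition conditions
      ccc {I} f incompatible = Code↣ℕ ↣-∘ mk↣ {to = code ∘ f} λ {i} {j} eq →
        decidable-stable (em {i ≡ j}) λ i≢j →
          incompatible i j i≢j (≡-code⇒Compatible (f i) (f j) eq)

      MA⇒adjustment : MA κ → HasBarelyAlternatingAdjustment _⊏_ a
      MA⇒adjustment ma with ma conditions empty ccc κ (mk↣ λ eq → eq) (λ x p → x ∈ dom p) dom-dense
      ... | G , filter , meets = generic-adjustment G filter meets

-- Transfer between `κ` and the reals in `X`

module _ (em : Classical) {ℓ : Level} {κ : Set} {X : Pred ℝ ℓ} (card : HasCardinality X κ)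
  (A : Family X) where

  private
    module A = Func A
    module ≃ = Setoid ℝ-setoid
    open Bijection card using (to; to⁻; injective; strictlySurjective)

    real : κ → ℝ
    real = proj₁ ∘ to

    to∘to⁻ : ∀ x → real (to⁻ x) ≃ proj₁ x
    to∘to⁻ x = proj₂ (strictlySurjective x)

    to⁻∘to : ∀ x → proj₁ x ≃ real (to⁻ x)
    to⁻∘to x = ≃.sym {real (to⁻ x)} {proj₁ x} (to∘to⁻ x)

    to⁻-cong : ∀ x y → proj₁ x ≃ proj₁ y → to⁻ x ≡ to⁻ y
    to⁻-cong x y x≃y = injective
      (≃.trans {real (to⁻ x)} {proj₁ x} {real (to⁻ y)} (to∘to⁻ x)
        (≃.trans {proj₁ x} {proj₁ y} {real (to⁻ y)} x≃y (to⁻∘to y)))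

    _⊏_ : κ → κ → Set
    k ⊏ l = real k < real l

    to⁻-mono : ∀ x y → proj₁ x < proj₁ y → to⁻ x ⊏ to⁻ y
    to⁻-mono x y =
      <-resp-≃ {proj₁ x} {real (to⁻ x)} {proj₁ y} {real (to⁻ y)} (to⁻∘to x) (to⁻∘to y)

    -- Incomparable reals are equal as reals, and injectivity of the bijection turns this into
    -- equality of indices.
    ⊏-compare : Trichotomous _≡_ _⊏_
    ⊏-compare k l with em {P = k ⊏ l} | em {P = l ⊏ k}
    ... | yes k⊏l | _ = tri< k⊏l
      (λ where refl → ℝ-<-irrefl (real k) k⊏l)
      (λ l⊏k → ℝ-<-irrefl (real k) (ℝ-<-trans (real k) (real l) (real k) k⊏l l⊏k))
    ... | no k⋢l | yes l⊏k = tri> k⋢l (λ where refl → k⋢l l⊏k) l⊏k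
    ... | no k⋢l | no l⋢k = tri≈ k⋢l (injective (≮∧≯⇒≃ (real k) (real l) k⋢l l⋢k)) l⋢k

    sto : IsStrictTotalOrder _≡_ _⊏_
    sto = isStrictTotalOrderᶜ record
      { isEquivalence = isEquivalence
      ; trans         = λ {k} {l} {m} → ℝ-<-trans (real k) (real l) (real m)
      ; compare       = ⊏-compare
      }

    a : κ → ℕ → Bool
    a k n = ⌊ em {P = A.to (to k) n} ⌋

    a-chain : IsAlmostChain A → ∀ {k l} → k ⊏ l → Eventually (λ n → a k n Bool.≤ a l n)
    a-chain chain {k} {l} k⊏l =
      eventually-map implies⇒≤ (⊆*⇒eventually em (chain (to k) (to l) k⊏l))
      where
      implies⇒≤ : ∀ {n} → (A.to (to k) n → A.to (to l) n) → a k n Bool.≤ a l n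
      implies⇒≤ {n} k⇒l with em {P = A.to (to k) n} | em {P = A.to (to l) n}
      ... | no  _   | yes _   = Bool.f≤t
      ... | no  _   | no  _   = Bool.b≤b
      ... | yes _   | yes _   = Bool.b≤b
      ... | yes n∈k | no  n∉l = contradiction (k⇒l n∈k) n∉l

    module _ (b : κ → ℕ → Bool) where

      B : Family X
      B = record
        { to   = λ x n → T (b (to⁻ x) n)
        ; cong = λ {x} {y} x≃y →
            A.Eq₂.reflexive (cong (λ k n → T (b k n)) (to⁻-cong x y x≃y))
        }

      B-adjusts : (∀ k → Eventually (λ n → b k n ≡ a k n)) → IsFiniteAdjustment B A
      B-adjusts b≡a x =
        eventually⇒⊆* (eventually-map
          (λ eq n∈A → subst T (sym eq) (fromWitness (proj₂ A≐ n∈A))) (b≡a (to⁻ x))) ,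
        eventually⇒⊆* (eventually-map
          (λ eq n∈B → proj₁ A≐ (toWitness (subst T eq n∈B))) (b≡a (to⁻ x)))
        where
        A≐ : A.to (to (to⁻ x)) ≐ A.to x
        A≐ = A.cong {to (to⁻ x)} {x} (to∘to⁻ x)

      B-alternates : (∀ n {k₁ k₂ k₃ k₄} → k₁ ⊏ k₂ → k₂ ⊏ k₃ → k₃ ⊏ k₄ →
          b k₁ n ≡ true → b k₂ n ≡ false → b k₃ n ≡ true → b k₄ n ≡ false → ⊥) →
        IsBarelyAlternating B
      B-alternates alt x₁ x₂ x₃ x₄ h₁ h₂ h₃ {n} (n∈₁ , n∈₃)
        with b (to⁻ x₂) n in eq₂ | b (to⁻ x₄) n in eq₄
      ... | true  | _     = inj₁ _
      ... | false | true  = inj₂ _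
      ... | false | false = ⊥-elim (alt n
        (to⁻-mono x₁ x₂ h₁) (to⁻-mono x₂ x₃ h₂) (to⁻-mono x₃ x₄ h₃)
        (Equivalence.to Bool.T-≡ n∈₁) eq₂ (Equivalence.to Bool.T-≡ n∈₃) eq₄)

  barely-alternating-adjustment : MA κ → IsAlmostChain A → κ →
    ∃[ B ] IsFiniteAdjustment B A × IsBarelyAlternating B
  barely-alternating-adjustment ma chain k₀ =
    let d , between = countable-order-dense em real k₀
        b , b≡a , alt = MA⇒adjustment em _⊏_ sto a (a-chain chain) (×-↣ℕ ℚ↣ℕ ℚ↣ℕ) d between ma
    in B b , B-adjusts b b≡a , B-alternates b alt

theorem1p3 : Classical → ∀ {ℓ : Level} (κ : Set) → MA κ →
    (X : Pred ℝ ℓ) → HasCardinality X κ →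
    (A : Family X) → IsAlmostChain A →
    ∃[ B ] IsFiniteAdjustment B A × IsBarelyAlternating B
theorem1p3 em κ ma X card A chain with em {P = κ}
-- With `κ` empty, `X` is empty and `A` serves vacuously; otherwise `k₀` supplies the default value
-- of `d`.
... | no ∄κ  = A , (λ x → ⊥-elim (∄κ (to⁻ x))) , λ x → ⊥-elim (∄κ (to⁻ x))
  where open Bijection card using (to⁻)
... | yes k₀ = barely-alternating-adjustment em card A ma chain k₀
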